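{- Let $k\ge 1$ be an integer, let $g$ be a graph, let $S\subseteq V(g)$ be a nonempty $k$-defective clique, and let $lb\ge 0$ be an integer (the size of the currently found best solution). Let $u\in S$ and $v\in V(g)\setminus S$, and put $S'=S\cup\{v\}$ and $T=V(g)\setminus S'$. Let $cn(u,v)$ be the number of common neighbors of $u$ and $v$ in $T$, let $cnon(u,v)$ be the number of common non-neighbors of $u$ and $v$ in $T$, and let $xn(u,v)$ be the number of vertices of $T$ adjacent to exactly one of $u$ and $v$. If $$|S'|+cn(u,v)+\min\bigl(k-|\overline{E}(S')|,\,xn(u,v)\bigr)+\min\Bigl(cnon(u,v),\,\max\Bigl(0,\Bigl\lfloor\tfrac{k-|\overline{E}(S')|-xn(u,v)}{2}\Bigr\rfloor\Bigr)\Bigr)\le lb,$$ then $v$ can be removed from $g$; that is, every $k$-defective clique $C$ with $S\cup\{v\}\subseteq C\subseteq V(g)$ satisfies $|C|\le lb$.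
   Context: All graphs are finite, simple and undirected. For a vertex set $A\subseteq V(g)$, $\overline{E}(A)$ is the set of non-edges (unordered pairs of distinct non-adjacent vertices) of the subgraph of $g$ induced by $A$; $A$ is a $k$-defective clique if $|\overline{E}(A)|\le k$. A non-neighbor of a vertex $u$ is a vertex different from $u$ and not adjacent to $u$. In a branch-and-bound search for a maximum $k$-defective clique, with $lb$ the size of the best solution found so far, only solutions of size greater than $lb$ are of interest, so a vertex $v\in V(g)\setminus S$ "can be removed from $g$" if no $k$-defective clique of size greater than $lb$ in $g$ contains $S\cup\{v\}$. -}

module Defs where

open import Data.Fin using (Fin; _<_; _<?_; _≟_)
open import Data.Fin.Subset using (Subset; _∈_; ∣_∣; _∩_; _∪_; ∁)
open import Data.Fin.Subset.Properties using (_∈?_)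
open import Data.List using (List; allFin; cartesianProduct; filter; length)
open import Data.Nat using (ℕ; _≤_)
open import Data.Product using (_×_; _,_)
open import Data.Vec using (tabulate)
open import Level using (0ℓ)
open import Relation.Binary.Core using (Rel)
open import Relation.Binary.Definitions using (Decidable; Symmetric)
open import Relation.Binary.PropositionalEquality using (_≢_)
open import Relation.Nullary using (¬_; does; ¬?; _×-dec_)
import Relation.Unary as U

record Graph (n : ℕ) : Set₁ where
  field
    Adj    : Rel (Fin n) 0ℓ
    adj?   : Decidable Adj
    symm   : Symmetric Adj
    irrefl : ∀ x → ¬ Adj x x

module _ {n : ℕ} where

  ⟦_⟧ : {P : Fin n → Set} → U.Decidable P → Subset n
  ⟦ P? ⟧ = tabulate (λ x → does (P? x))

  module _ (g : Graph n) where
    open Graph g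

    NonNeighbor : Rel (Fin n) 0ℓ
    NonNeighbor u w = w ≢ u × ¬ Adj u w

    nonNeighbor? : Decidable NonNeighbor
    nonNeighbor? u w = ¬? (w ≟ u) ×-dec ¬? (adj? u w)

    neighbors : Fin n → Subset n
    neighbors u = ⟦ adj? u ⟧

    nonNeighbors : Fin n → Subset n
    nonNeighbors u = ⟦ nonNeighbor? u ⟧

    -- Each unordered pair of distinct vertices {x, y} is represented by
    -- its unique ordering with x < y.
    IsNonEdge : Subset n → Fin n × Fin n → Set
    IsNonEdge A (x , y) = x < y × x ∈ A × y ∈ A × ¬ Adj x y

    isNonEdge? : (A : Subset n) → U.Decidable (IsNonEdge A)
    isNonEdge? A (x , y) =
      x <? y ×-dec x ∈? A ×-dec y ∈? A ×-dec ¬? (adj? x y)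

    nonEdges : Subset n → List (Fin n × Fin n)
    nonEdges A = filter (isNonEdge? A) (cartesianProduct (allFin n) (allFin n))

    IsDefectiveClique : ℕ → Subset n → Set
    IsDefectiveClique k A = length (nonEdges A) ≤ k

    cn : Subset n → Fin n → Fin n → ℕ
    cn T u v = ∣ T ∩ neighbors u ∩ neighbors v ∣

    cnon : Subset n → Fin n → Fin n → ℕ
    cnon T u v = ∣ T ∩ nonNeighbors u ∩ nonNeighbors v ∣

    xn : Subset n → Fin n → Fin n → ℕ
    xn T u v =
      ∣ T ∩ ((neighbors u ∩ ∁ (neighbors v)) ∪ (neighbors v ∩ ∁ (neighbors u))) ∣

{-# OPTIONS --safe #-}

-- Let C be a k-defective clique containing S', and let P and Q be the sets of
-- non-neighbours of u and of v in C ∖ S'.  Every vertex of P gives a non-edge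
-- of C at u and every vertex of Q one at v; these are distinct and not inside
-- S', so ∣P ∪ Q∣ + ∣P ∩ Q∣ = ∣P∣ + ∣Q∣ ≤ r = k − ∣Ē(S')∣.  Moreover
-- ∣C∣ ≤ ∣S'∣ + cn + ∣P ∪ Q∣, ∣P ∪ Q∣ ≤ xn + ∣P ∩ Q∣ and ∣P ∩ Q∣ ≤ cnon.
-- Hence j = ∣P ∪ Q∣ − xn satisfies j ≤ ∣P ∩ Q∣ ≤ cnon and
-- 2j ≤ j + ∣P ∩ Q∣ ≤ r − xn, which bounds ∣P ∪ Q∣ when xn ≤ r; when r ≤ xn,
-- ∣P ∪ Q∣ ≤ r suffices.

module Submission where

open import Defs
open import Data.Fin using (Fin)
open import Data.Fin.Subset using (Subset; Nonempty; _∈_; _∉_; _⊆_; _∪_; ⁅_⁆; ∁; ∣_∣)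
open import Data.Integer using (+_; 0ℤ; _+_; _-_; _⊓_; _⊔_; _/ℕ_; _≤_)
open import Data.List using (length)
open import Data.Nat as ℕ using (ℕ)

open import Data.Empty using (⊥)
import Data.Fin as Fin
import Data.Fin.Properties as Fin
open import Data.Fin.Subset using (_∩_; inside; outside)
open import Data.Fin.Subset.Properties
open import Data.Integer using (+≤+)
import Data.Integer.Properties as ℤ
open import Data.List using (List; []; _∷_; _++_; map; allFin; cartesianProduct)
open import Data.List.Membership.Propositional using () renaming (_∈_ to _∈ˡ_)
open import Data.List.Membership.Propositional.Properties
  using (∈-∃++; ∈-filter⁺; ∈-filter⁻; ∈-cartesianProduct⁺; ∈-allFin; ∈-map⁻; ∈-++⁻)
open import Data.List.Properties using (length-++; length-map)
open import Data.List.Relation.Binary.Permutation.Propositional.Properties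
  using (↭-length; shift)
open import Data.List.Relation.Binary.Subset.Propositional using () renaming (_⊆_ to _⊆ˡ_)
open import Data.List.Relation.Binary.Subset.Propositional.Properties
  using (⊆-reflexive-↭; ⊆∷∧∉⇒⊆)
import Data.List.Relation.Unary.All as All
open import Data.List.Relation.Unary.Any using (here; there)
open import Data.List.Relation.Unary.AllPairs using ([]; _∷_)
open import Data.List.Relation.Unary.Unique.Propositional using (Unique)
open import Data.List.Relation.Unary.Unique.Propositional.Properties as Unique
  using (Unique[x∷xs]⇒x∉xs)
import Data.Nat.DivMod as ℕ
import Data.Nat.Properties as ℕ
open import Data.Product using (_×_; _,_; proj₁; proj₂)
open import Data.Sum using (_⊎_; inj₁; inj₂; [_,_]′)
import Data.Vec as Vec
open import Data.Vec.Properties using (lookup∘tabulate; lookup⇒[]=; []=⇒lookup)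
open import Function using (_∘_)
open import Relation.Binary.PropositionalEquality
open import Relation.Nullary using (¬_; does; yes; no)
open import Relation.Nullary.Decidable using (dec-true)
import Relation.Unary as U

-- Cardinalities of lists and finite subsets.

length-mono-⊆ : ∀ {a} {A : Set a} {xs ys : List A} →
                Unique xs → xs ⊆ˡ ys → length xs ℕ.≤ length ys
length-mono-⊆ {xs = []} _ _ = ℕ.z≤n
length-mono-⊆ {xs = x ∷ xs} u@(_ ∷ uxs) sub with ∈-∃++ (sub (here refl))
-- Bringing `x` to the front turns the longer list into `x ∷ ps ++ qs`. Since `x` does not recur in
-- `xs`, the tail is already contained in `ps ++ qs`, and induction applies.
... | ps , qs , refl = subst (length (x ∷ xs) ℕ.≤_) (sym (↭-length (shift x ps qs)))
  (ℕ.s≤s (length-mono-⊆ uxs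
    (⊆∷∧∉⇒⊆ (⊆-reflexive-↭ (shift x ps qs) ∘ sub ∘ there) (Unique[x∷xs]⇒x∉xs u))))

∣p∪q∣+∣p∩q∣≡∣p∣+∣q∣ : ∀ {n} (p q : Subset n) →
                      ∣ p ∪ q ∣ ℕ.+ ∣ p ∩ q ∣ ≡ ∣ p ∣ ℕ.+ ∣ q ∣
∣p∪q∣+∣p∩q∣≡∣p∣+∣q∣ Vec.[] Vec.[] = refl
∣p∪q∣+∣p∩q∣≡∣p∣+∣q∣ (outside Vec.∷ p) (outside Vec.∷ q) = ∣p∪q∣+∣p∩q∣≡∣p∣+∣q∣ p q
∣p∪q∣+∣p∩q∣≡∣p∣+∣q∣ (inside Vec.∷ p) (outside Vec.∷ q) =
  cong ℕ.suc (∣p∪q∣+∣p∩q∣≡∣p∣+∣q∣ p q)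
∣p∪q∣+∣p∩q∣≡∣p∣+∣q∣ (outside Vec.∷ p) (inside Vec.∷ q) =
  trans (cong ℕ.suc (∣p∪q∣+∣p∩q∣≡∣p∣+∣q∣ p q)) (sym (ℕ.+-suc ∣ p ∣ ∣ q ∣))
∣p∪q∣+∣p∩q∣≡∣p∣+∣q∣ (inside Vec.∷ p) (inside Vec.∷ q) =
  cong ℕ.suc (trans (ℕ.+-suc ∣ p ∪ q ∣ ∣ p ∩ q ∣)
    (trans (cong ℕ.suc (∣p∪q∣+∣p∩q∣≡∣p∣+∣q∣ p q)) (sym (ℕ.+-suc ∣ p ∣ ∣ q ∣))))

r⊆p∪q⇒∣r∣≤∣p∣+∣q∣ : ∀ {n} {p q r : Subset n} → r ⊆ p ∪ q → ∣ r ∣ ℕ.≤ ∣ p ∣ ℕ.+ ∣ q ∣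
r⊆p∪q⇒∣r∣≤∣p∣+∣q∣ {p = p} {q} {r} r⊆p∪q = begin
  ∣ r ∣                      ≤⟨ p⊆q⇒∣p∣≤∣q∣ r⊆p∪q ⟩
  ∣ p ∪ q ∣                  ≤⟨ ℕ.m≤m+n _ _ ⟩
  ∣ p ∪ q ∣ ℕ.+ ∣ p ∩ q ∣    ≡⟨ ∣p∪q∣+∣p∩q∣≡∣p∣+∣q∣ p q ⟩
  ∣ p ∣ ℕ.+ ∣ q ∣            ∎
  where open ℕ.≤-Reasoning

-- Enumerates a subset without repetition, so that its vertices can be mapped to non-edges and
-- counted against the list `nonEdges`.
elements : ∀ {n} → Subset n → List (Fin n)
elements Vec.[] = []
elements (inside Vec.∷ p) = Fin.zero ∷ map Fin.suc (elements p)
elements (outside Vec.∷ p) = map Fin.suc (elements p)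

length-elements : ∀ {n} (p : Subset n) → length (elements p) ≡ ∣ p ∣
length-elements Vec.[] = refl
length-elements (inside Vec.∷ p) =
  cong ℕ.suc (trans (length-map Fin.suc (elements p)) (length-elements p))
length-elements (outside Vec.∷ p) =
  trans (length-map Fin.suc (elements p)) (length-elements p)

∈-elements⁻ : ∀ {n} (p : Subset n) {x} → x ∈ˡ elements p → x ∈ p
∈-elements⁻ (inside Vec.∷ p) (here refl) = Vec.here
∈-elements⁻ (inside Vec.∷ p) (there x∈) with ∈-map⁻ Fin.suc x∈
... | _ , y∈ , refl = Vec.there (∈-elements⁻ p y∈)
∈-elements⁻ (outside Vec.∷ p) x∈ with ∈-map⁻ Fin.suc x∈
... | _ , y∈ , refl = Vec.there (∈-elements⁻ p y∈)

elements-unique : ∀ {n} (p : Subset n) → Unique (elements p)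
elements-unique Vec.[] = []
elements-unique (inside Vec.∷ p) =
  All.tabulate (λ x∈ 0≡x → zero∉ (subst (_∈ˡ _) (sym 0≡x) x∈))
  ∷ Unique.map⁺ Fin.suc-injective (elements-unique p)
  where
  zero∉ : ¬ Fin.zero ∈ˡ map Fin.suc (elements p)
  zero∉ 0∈ with ∈-map⁻ Fin.suc 0∈
  ... | _ , _ , ()
elements-unique (outside Vec.∷ p) = Unique.map⁺ Fin.suc-injective (elements-unique p)

-- Membership in comprehensions, and sorted pairs of vertices.

module _ {n : ℕ} {P : Fin n → Set} (P? : U.Decidable P) where

  ∈⟦⟧⁺ : ∀ {x} → P x → x ∈ ⟦ P? ⟧
  ∈⟦⟧⁺ {x} Px = lookup⇒[]= x _ (trans (lookup∘tabulate _ x) (dec-true (P? x) Px))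

  ∈⟦⟧⁻ : ∀ {x} → x ∈ ⟦ P? ⟧ → P x
  ∈⟦⟧⁻ {x} x∈ with P? x | trans (sym (lookup∘tabulate (does ∘ P?) x)) ([]=⇒lookup x∈)
  -- A negative decision would equate `outside` with `inside`, so that case is empty.
  ... | yes Px | _ = Px

-- Follows the convention of `IsNonEdge`: for distinct arguments this is the representative of the
-- unordered pair that occurs in `nonEdges`.
sortPair : ∀ {n} → Fin n → Fin n → Fin n × Fin n
sortPair x y with x Fin.<? y
... | yes _ = x , y
... | no  _ = y , x

sortPair-injective : ∀ {n} (x y x′ y′ : Fin n) → sortPair x y ≡ sortPair x′ y′ →
                     (x ≡ x′ × y ≡ y′) ⊎ (x ≡ y′ × y ≡ x′)
sortPair-injective x y x′ y′ eq with x Fin.<? y | x′ Fin.<? y′ | eq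
... | yes _ | yes _ | refl = inj₁ (refl , refl)
... | yes _ | no  _ | refl = inj₂ (refl , refl)
... | no  _ | yes _ | refl = inj₂ (refl , refl)
... | no  _ | no  _ | refl = inj₁ (refl , refl)

sortPair-injectiveʳ : ∀ {n} (x : Fin n) {y z} → sortPair x y ≡ sortPair x z → y ≡ z
sortPair-injectiveʳ x {y} {z} eq with sortPair-injective x y x z eq
... | inj₁ (_ , y≡z)   = y≡z
... | inj₂ (x≡z , y≡x) = trans y≡x x≡z

-- Non-edges gained when a vertex set grows.

module _ {n : ℕ} (g : Graph n) where
  open Graph g

  nonEdges-unique : ∀ A → Unique (nonEdges g A)
  nonEdges-unique A = Unique.filter⁺ (isNonEdge? g A)
    (Unique.cartesianProduct⁺ (Unique.allFin⁺ n) (Unique.allFin⁺ n))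

  ∈-nonEdges⁺ : ∀ {A e} → IsNonEdge g A e → e ∈ˡ nonEdges g A
  ∈-nonEdges⁺ {A} = ∈-filter⁺ (isNonEdge? g A) (∈-cartesianProduct⁺ (∈-allFin _) (∈-allFin _))

  ∈-nonEdges⁻ : ∀ A {e} → e ∈ˡ nonEdges g A → IsNonEdge g A e
  ∈-nonEdges⁻ A = proj₂ ∘ ∈-filter⁻ (isNonEdge? g A) {xs = cartesianProduct (allFin n) (allFin n)}

  nonEdges-mono : ∀ {A C} → A ⊆ C → nonEdges g A ⊆ˡ nonEdges g C
  nonEdges-mono {A} A⊆C e∈ with ∈-nonEdges⁻ A e∈
  ... | x<y , x∈A , y∈A , ¬xy = ∈-nonEdges⁺ (x<y , A⊆C x∈A , A⊆C y∈A , ¬xy)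

  sortPair∈nonEdges⁺ : ∀ {A x y} → x ∈ A → y ∈ A → NonNeighbor g x y →
                       sortPair x y ∈ˡ nonEdges g A
  sortPair∈nonEdges⁺ {x = x} {y} x∈A y∈A (y≢x , ¬xy) with x Fin.<? y
  ... | yes x<y = ∈-nonEdges⁺ (x<y , x∈A , y∈A , ¬xy)
  ... | no  x≮y = ∈-nonEdges⁺
    (ℕ.≤∧≢⇒< (ℕ.≮⇒≥ x≮y) (y≢x ∘ Fin.toℕ-injective) , y∈A , x∈A , ¬xy ∘ symm)

  -- Used contrapositively: a pair whose second vertex lies outside `A` is not among the non-edges
  -- inside `A`.
  sortPair∈nonEdges⁻ : ∀ A x y → sortPair x y ∈ˡ nonEdges g A → y ∈ A
  sortPair∈nonEdges⁻ A x y e∈ with x Fin.<? y | ∈-nonEdges⁻ A e∈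
  ... | yes _ | _ , _ , y∈A , _ = y∈A
  ... | no  _ | _ , y∈A , _ , _ = y∈A

  module _ {A C P Q : Subset n} {u v : Fin n} (A⊆C : A ⊆ C)
           (u∈A : u ∈ A) (v∈A : v ∈ A) (u≢v : u ≢ v)
           (P⊆ : P ⊆ (C ∩ ∁ A) ∩ nonNeighbors g u)
           (Q⊆ : Q ⊆ (C ∩ ∁ A) ∩ nonNeighbors g v) where

    private
      outsideNonNeighbor : ∀ {B z w} → B ⊆ (C ∩ ∁ A) ∩ nonNeighbors g z →
        w ∈ˡ elements B → w ∈ C × w ∉ A × NonNeighbor g z w
      outsideNonNeighbor {B} {z} B⊆ w∈ with x∈p∩q⁻ (C ∩ ∁ A) _ (B⊆ (∈-elements⁻ B w∈))
      ... | w∈C∖A , w∈N with x∈p∩q⁻ C (∁ A) w∈C∖A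
      ... | w∈C , w∈∁A = w∈C , x∈∁p⇒x∉p w∈∁A , ∈⟦⟧⁻ (nonNeighbor? g z) w∈N

      pairs : Fin n → Subset n → List (Fin n × Fin n)
      pairs z B = map (sortPair z) (elements B)

      pairs-unique : ∀ z B → Unique (pairs z B)
      pairs-unique z B = Unique.map⁺ (sortPair-injectiveʳ z) (elements-unique B)

      length-pairs : ∀ z B → length (pairs z B) ≡ ∣ B ∣
      length-pairs z B = trans (length-map (sortPair z) (elements B)) (length-elements B)

      pairs⊆nonEdges : ∀ {z B} → z ∈ A → B ⊆ (C ∩ ∁ A) ∩ nonNeighbors g z →
                       pairs z B ⊆ˡ nonEdges g C
      pairs⊆nonEdges {z} z∈A B⊆ e∈ with ∈-map⁻ (sortPair z) e∈
      ... | w , w∈ , refl with outsideNonNeighbor B⊆ w∈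
      ... | w∈C , _ , zw = sortPair∈nonEdges⁺ (A⊆C z∈A) w∈C zw

      nonEdges#pairs : ∀ {z B e} → B ⊆ (C ∩ ∁ A) ∩ nonNeighbors g z →
                       e ∈ˡ nonEdges g A × e ∈ˡ pairs z B → ⊥
      nonEdges#pairs {z} B⊆ (e∈ , e∈′) with ∈-map⁻ (sortPair z) e∈′
      ... | w , w∈ , refl =
        proj₁ (proj₂ (outsideNonNeighbor B⊆ w∈)) (sortPair∈nonEdges⁻ A z w e∈)

      -- If the pairs `u`, `w` and `v`, `w′` coincided, then `u ≢ v` would force `u` to be `w′`; but
      -- `w′` lies outside `A`, while `u` lies in it.
      pairs#pairs : ∀ {e} → e ∈ˡ pairs u P × e ∈ˡ pairs v Q → ⊥
      pairs#pairs (e∈ , e∈′) with ∈-map⁻ (sortPair u) e∈ | ∈-map⁻ (sortPair v) e∈′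
      ... | w , w∈ , refl | w′ , w′∈ , eq with sortPair-injective u w v w′ eq
      ... | inj₁ (u≡v , _) = u≢v u≡v
      ... | inj₂ (refl , _) = proj₁ (proj₂ (outsideNonNeighbor Q⊆ w′∈)) u∈A

    -- The non-edges inside `A`, those from `u` to `P` and those from `v` to `Q` form three
    -- repetition-free, pairwise disjoint lists of non-edges of `C`. A vertex in both `P` and `Q` is
    -- thus rightly charged twice.
    nonEdges-extend : length (nonEdges g A) ℕ.+ (∣ P ∣ ℕ.+ ∣ Q ∣) ℕ.≤ length (nonEdges g C)
    nonEdges-extend = begin
      length (nonEdges g A) ℕ.+ (∣ P ∣ ℕ.+ ∣ Q ∣)
        ≡⟨ cong (length (nonEdges g A) ℕ.+_)
             (cong₂ ℕ._+_ (length-pairs u P) (length-pairs v Q)) ⟨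
      length (nonEdges g A) ℕ.+ (length (pairs u P) ℕ.+ length (pairs v Q))
        ≡⟨ cong (length (nonEdges g A) ℕ.+_) (length-++ (pairs u P)) ⟨
      length (nonEdges g A) ℕ.+ length (pairs u P ++ pairs v Q)
        ≡⟨ length-++ (nonEdges g A) ⟨
      length (nonEdges g A ++ pairs u P ++ pairs v Q)
        ≤⟨ length-mono-⊆ unique included ⟩
      length (nonEdges g C) ∎
      where
      open ℕ.≤-Reasoning

      unique : Unique (nonEdges g A ++ pairs u P ++ pairs v Q)
      unique = Unique.++⁺ (nonEdges-unique A)
        (Unique.++⁺ (pairs-unique u P) (pairs-unique v Q) pairs#pairs)
        λ (e∈ , e∈′) → [ (λ e∈P → nonEdges#pairs P⊆ (e∈ , e∈P))
                       , (λ e∈Q → nonEdges#pairs Q⊆ (e∈ , e∈Q)) ]′ (∈-++⁻ (pairs u P) e∈′)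

      included : nonEdges g A ++ pairs u P ++ pairs v Q ⊆ˡ nonEdges g C
      included = [ nonEdges-mono A⊆C
                 , [ pairs⊆nonEdges u∈A P⊆ , pairs⊆nonEdges v∈A Q⊆ ]′ ∘ ∈-++⁻ (pairs u P)
                 ]′ ∘ ∈-++⁻ (nonEdges g A)

  -- Vertices sorted by their adjacency to `u` and `v`.

  module _ (D : Subset n) (u v : Fin n) (D≢u : ∀ {w} → w ∈ D → w ≢ u)
           (D≢v : ∀ {w} → w ∈ D → w ≢ v) where

    private
      P = D ∩ nonNeighbors g u
      Q = D ∩ nonNeighbors g v

      ∈P⁺ : ∀ {w} → w ∈ D → ¬ Adj u w → w ∈ P
      ∈P⁺ w∈D ¬uw = x∈p∩q⁺ (w∈D , ∈⟦⟧⁺ (nonNeighbor? g u) (D≢u w∈D , ¬uw))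

      ∈Q⁺ : ∀ {w} → w ∈ D → ¬ Adj v w → w ∈ Q
      ∈Q⁺ w∈D ¬vw = x∈p∩q⁺ (w∈D , ∈⟦⟧⁺ (nonNeighbor? g v) (D≢v w∈D , ¬vw))

      ∈P⁻ : ∀ {w} → w ∈ P → w ∈ D × ¬ Adj u w
      ∈P⁻ w∈P with x∈p∩q⁻ D _ w∈P
      ... | w∈D , w∈N = w∈D , proj₂ (∈⟦⟧⁻ (nonNeighbor? g u) w∈N)

      ∈Q⁻ : ∀ {w} → w ∈ Q → w ∈ D × ¬ Adj v w
      ∈Q⁻ w∈Q with x∈p∩q⁻ D _ w∈Q
      ... | w∈D , w∈N = w∈D , proj₂ (∈⟦⟧⁻ (nonNeighbor? g v) w∈N)

    commonNeighbor-or-nonNeighbor : ∀ {T} → D ⊆ T →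
      D ⊆ (T ∩ neighbors g u ∩ neighbors g v) ∪ (P ∪ Q)
    commonNeighbor-or-nonNeighbor D⊆T {w} w∈D with adj? u w | adj? v w
    ... | no ¬uw | _      = x∈p∪q⁺ (inj₂ (x∈p∪q⁺ (inj₁ (∈P⁺ w∈D ¬uw))))
    ... | yes _  | no ¬vw = x∈p∪q⁺ (inj₂ (x∈p∪q⁺ (inj₂ (∈Q⁺ w∈D ¬vw))))
    ... | yes uw | yes vw = x∈p∪q⁺ (inj₁
      (x∈p∩q⁺ (D⊆T w∈D , x∈p∩q⁺ (∈⟦⟧⁺ (adj? u) uw , ∈⟦⟧⁺ (adj? v) vw))))

    -- A vertex missing one of `u` and `v` either sees the other, and is counted by `xn`, or misses
    -- both.
    exclusive-or-common : ∀ {T} → D ⊆ T → P ∪ Q ⊆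
      (T ∩ ((neighbors g u ∩ ∁ (neighbors g v)) ∪ (neighbors g v ∩ ∁ (neighbors g u))))
        ∪ (P ∩ Q)
    exclusive-or-common D⊆T {w} w∈ with x∈p∪q⁻ P Q w∈
    ... | inj₁ w∈P with ∈P⁻ w∈P | adj? v w
    ...   | w∈D , ¬uw | no ¬vw = x∈p∪q⁺ (inj₂ (x∈p∩q⁺ (w∈P , ∈Q⁺ w∈D ¬vw)))
    ...   | w∈D , ¬uw | yes vw = x∈p∪q⁺ (inj₁ (x∈p∩q⁺ (D⊆T w∈D , x∈p∪q⁺ (inj₂
      (x∈p∩q⁺ (∈⟦⟧⁺ (adj? v) vw , x∉p⇒x∈∁p (¬uw ∘ ∈⟦⟧⁻ (adj? u))))))))
    exclusive-or-common D⊆T {w} w∈ | inj₂ w∈Q with ∈Q⁻ w∈Q | adj? u w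
    ...   | w∈D , ¬vw | no ¬uw = x∈p∪q⁺ (inj₂ (x∈p∩q⁺ (∈P⁺ w∈D ¬uw , w∈Q)))
    ...   | w∈D , ¬vw | yes uw = x∈p∪q⁺ (inj₁ (x∈p∩q⁺ (D⊆T w∈D , x∈p∪q⁺ (inj₁
      (x∈p∩q⁺ (∈⟦⟧⁺ (adj? u) uw , x∉p⇒x∈∁p (¬vw ∘ ∈⟦⟧⁻ (adj? v))))))))

    P∩Q⊆commonNonNeighbors : ∀ {T} → D ⊆ T →
      P ∩ Q ⊆ T ∩ nonNeighbors g u ∩ nonNeighbors g v
    P∩Q⊆commonNonNeighbors D⊆T w∈ with x∈p∩q⁻ P Q w∈
    ... | w∈P , w∈Q with x∈p∩q⁻ D _ w∈P | x∈p∩q⁻ D _ w∈Q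
    ... | w∈D , w∈Nu | _ , w∈Nv = x∈p∩q⁺ (D⊆T w∈D , x∈p∩q⁺ (w∈Nu , w∈Nv))

-- Arithmetic of the bound.

m-n≡m∸n : ∀ {m n} → n ℕ.≤ m → + m - + n ≡ + (m ℕ.∸ n)
m-n≡m∸n {m} {n} n≤m = trans (ℤ.m-n≡m⊖n m n) (ℤ.⊖-≥ n≤m)

-- To be read with `m` as ∣P ∪ Q∣, `c` as ∣P ∩ Q∣, `r` as the number of non-edges still allowed, `x`
-- as `xn` and `d` as `cnon`.
overlap-bound : ∀ {m c r x d} → m ℕ.+ c ℕ.≤ r → m ℕ.≤ x ℕ.+ c → c ℕ.≤ d →
              + m ≤ (+ r ⊓ + x) + (+ d ⊓ (0ℤ ⊔ ((+ r - + x) /ℕ 2)))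
overlap-bound {m} {c} {r} {x} {d} m+c≤r m≤x+c c≤d with ℕ.≤-total r x
... | inj₁ r≤x = begin
    + m                                                   ≤⟨ +≤+ (ℕ.m+n≤o⇒m≤o m m+c≤r) ⟩
    + r                                                   ≡⟨ ℤ.i≤j⇒i⊓j≡i (+≤+ r≤x) ⟨
    + r ⊓ + x                                             ≡⟨ ℤ.+-identityʳ _ ⟨
    -- The maximum with `0ℤ` keeps the last summand nonnegative even though `r - x` may be negative
    -- here.
    + r ⊓ + x + 0ℤ                                        ≤⟨ ℤ.+-monoʳ-≤ (+ r ⊓ + x)
      (ℤ.⊓-glb (+≤+ ℕ.z≤n) (ℤ.i≤i⊔j 0ℤ ((+ r - + x) /ℕ 2))) ⟩
    (+ r ⊓ + x) + (+ d ⊓ (0ℤ ⊔ ((+ r - + x) /ℕ 2)))       ∎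
  where open ℤ.≤-Reasoning
-- With `r - x` rewritten as a natural number, the maximum with `0ℤ` disappears by computation and
-- the goal becomes one about naturals.
... | inj₂ x≤r rewrite m-n≡m∸n x≤r | ℕ.m≥n⇒m⊓n≡n x≤r = +≤+ (begin
    m                                    ≤⟨ ℕ.m≤n+m∸n m x ⟩
    x ℕ.+ (m ℕ.∸ x)                      ≤⟨ ℕ.+-monoʳ-≤ x (ℕ.⊓-glb (ℕ.≤-trans m∸x≤c c≤d) m∸x≤half) ⟩
    x ℕ.+ (d ℕ.⊓ ((r ℕ.∸ x) ℕ./ 2))      ∎)
  where
  open ℕ.≤-Reasoning

  m∸x≤c : m ℕ.∸ x ℕ.≤ c
  m∸x≤c = ℕ.m≤n+o⇒m∸n≤o m x m≤x+c

  doubled : (m ℕ.∸ x) ℕ.* 2 ℕ.≤ r ℕ.∸ x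
  doubled with ℕ.≤-total m x
  -- Truncation makes `m ∸ x` zero here; the chain in the other case needs `x ≤ m` to move the
  -- subtraction past `c`.
  ... | inj₁ m≤x rewrite ℕ.m≤n⇒m∸n≡0 m≤x = ℕ.z≤n
  ... | inj₂ x≤m = begin
    (m ℕ.∸ x) ℕ.* 2                  ≡⟨ ℕ.*-comm (m ℕ.∸ x) 2 ⟩
    (m ℕ.∸ x) ℕ.+ ((m ℕ.∸ x) ℕ.+ 0)  ≡⟨ cong ((m ℕ.∸ x) ℕ.+_) (ℕ.+-identityʳ _) ⟩
    (m ℕ.∸ x) ℕ.+ (m ℕ.∸ x)          ≤⟨ ℕ.+-monoʳ-≤ (m ℕ.∸ x) m∸x≤c ⟩
    (m ℕ.∸ x) ℕ.+ c                  ≡⟨ ℕ.+-∸-comm c x≤m ⟨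
    (m ℕ.+ c) ℕ.∸ x                  ≤⟨ ℕ.∸-monoˡ-≤ x m+c≤r ⟩
    r ℕ.∸ x                          ∎

  m∸x≤half : m ℕ.∸ x ℕ.≤ (r ℕ.∸ x) ℕ./ 2
  m∸x≤half = begin
    m ℕ.∸ x                    ≡⟨ ℕ.m*n/n≡m (m ℕ.∸ x) 2 ⟨
    (m ℕ.∸ x) ℕ.* 2 ℕ./ 2      ≤⟨ ℕ./-monoˡ-≤ 2 doubled ⟩
    (r ℕ.∸ x) ℕ./ 2            ∎

-- The size of a defective clique containing `S'`.

mainTheorem4 : ∀ {n} (g : Graph n) (k lb : ℕ) → 1 ℕ.≤ k →
    (S : Subset n) → Nonempty S → IsDefectiveClique g k S →
    (u v : Fin n) → u ∈ S → v ∉ S →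
    let S' = S ∪ ⁅ v ⁆
        T  = ∁ S'
        r  = + k - + length (nonEdges g S')
        x  = + xn g T u v
    in
    + ∣ S' ∣ + + cn g T u v + (r ⊓ x) + ((+ cnon g T u v) ⊓ (0ℤ ⊔ ((r - x) /ℕ 2))) ≤ + lb →
    (C : Subset n) → IsDefectiveClique g k C → S' ⊆ C → ∣ C ∣ ℕ.≤ lb
mainTheorem4 {n} g k lb _ S _ _ u v u∈S v∉S bound C C-defective S'⊆C =
  ℤ.drop‿+≤+ (ℤ.≤-trans size bound)
  where
  S' = S ∪ ⁅ v ⁆
  T  = ∁ S'
  e  = length (nonEdges g S')
  r  = + k - + e
  x  = + xn g T u v
  half = (+ cnon g T u v) ⊓ (0ℤ ⊔ ((r - x) /ℕ 2))

  D = C ∩ T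
  P = D ∩ nonNeighbors g u
  Q = D ∩ nonNeighbors g v

  u∈S' : u ∈ S'
  u∈S' = x∈p∪q⁺ (inj₁ u∈S)

  v∈S' : v ∈ S'
  v∈S' = x∈p∪q⁺ (inj₂ (x∈⁅x⁆ v))

  u≢v : u ≢ v
  u≢v refl = v∉S u∈S

  D⊆T : D ⊆ T
  D⊆T = proj₂ ∘ x∈p∩q⁻ C T

  D≢ : ∀ {z} → z ∈ S' → ∀ {w} → w ∈ D → w ≢ z
  D≢ z∈S' w∈D refl = x∈∁p⇒x∉p (D⊆T w∈D) z∈S'

  C⊆S'∪D : C ⊆ S' ∪ D
  C⊆S'∪D {w} w∈C with w ∈? S'
  ... | yes w∈S' = x∈p∪q⁺ (inj₁ w∈S')
  ... | no  w∉S' = x∈p∪q⁺ (inj₂ (x∈p∩q⁺ (w∈C , x∉p⇒x∈∁p w∉S')))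

  budget : e ℕ.+ (∣ P ∪ Q ∣ ℕ.+ ∣ P ∩ Q ∣) ℕ.≤ k
  budget = begin
    e ℕ.+ (∣ P ∪ Q ∣ ℕ.+ ∣ P ∩ Q ∣)  ≡⟨ cong (e ℕ.+_) (∣p∪q∣+∣p∩q∣≡∣p∣+∣q∣ P Q) ⟩
    e ℕ.+ (∣ P ∣ ℕ.+ ∣ Q ∣)
      ≤⟨ nonEdges-extend g {P = P} {Q = Q} S'⊆C u∈S' v∈S' u≢v ⊆-refl ⊆-refl ⟩
    length (nonEdges g C)            ≤⟨ C-defective ⟩
    k                                ∎
    where open ℕ.≤-Reasoning

  ∣P∪Q∣-bound : + ∣ P ∪ Q ∣ ≤ (r ⊓ x) + half
  -- `budget` gives `e ≤ k`, so the integer `r` is the natural number `k ∸ e`.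
  ∣P∪Q∣-bound rewrite m-n≡m∸n (ℕ.m+n≤o⇒m≤o e budget) = overlap-bound
    (ℕ.m+n≤o⇒m≤o∸n _ (subst (ℕ._≤ k) (ℕ.+-comm e _) budget))
    (r⊆p∪q⇒∣r∣≤∣p∣+∣q∣ (exclusive-or-common g D u v (D≢ u∈S') (D≢ v∈S') D⊆T))
    (p⊆q⇒∣p∣≤∣q∣ (P∩Q⊆commonNonNeighbors g D u v (D≢ u∈S') (D≢ v∈S') D⊆T))

  ∣C∣-bound : ∣ C ∣ ℕ.≤ ∣ S' ∣ ℕ.+ cn g T u v ℕ.+ ∣ P ∪ Q ∣
  ∣C∣-bound = begin
    ∣ C ∣                                      ≤⟨ r⊆p∪q⇒∣r∣≤∣p∣+∣q∣ C⊆S'∪D ⟩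
    ∣ S' ∣ ℕ.+ ∣ D ∣                           ≤⟨ ℕ.+-monoʳ-≤ ∣ S' ∣ (r⊆p∪q⇒∣r∣≤∣p∣+∣q∣
      (commonNeighbor-or-nonNeighbor g D u v (D≢ u∈S') (D≢ v∈S') D⊆T)) ⟩
    ∣ S' ∣ ℕ.+ (cn g T u v ℕ.+ ∣ P ∪ Q ∣)      ≡⟨ ℕ.+-assoc ∣ S' ∣ _ _ ⟨
    ∣ S' ∣ ℕ.+ cn g T u v ℕ.+ ∣ P ∪ Q ∣        ∎
    where open ℕ.≤-Reasoning

  size : + ∣ C ∣ ≤ + ∣ S' ∣ + + cn g T u v + (r ⊓ x) + half
  size = begin
    + ∣ C ∣                                        ≤⟨ +≤+ ∣C∣-bound ⟩
    + ∣ S' ∣ + + cn g T u v + + ∣ P ∪ Q ∣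
      ≤⟨ ℤ.+-monoʳ-≤ (+ ∣ S' ∣ + + cn g T u v) ∣P∪Q∣-bound ⟩
    + ∣ S' ∣ + + cn g T u v + ((r ⊓ x) + half)
      ≡⟨ ℤ.+-assoc (+ ∣ S' ∣ + + cn g T u v) (r ⊓ x) half ⟨
    + ∣ S' ∣ + + cn g T u v + (r ⊓ x) + half       ∎
    where open ℤ.≤-Reasoning
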